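{- The set of axioms $\mathcal{S}=\{$(R1), (R2), (R3), (R4), (R5), (R6), (R8), (R8$'$), (R10)$\}$ is independent. That is, for each axiom $\varphi$ in $\mathcal{S}$, $\varphi$ is not derivable from the other axioms of $\mathcal{S}$: there is an algebra $(A,+,-,;,{}^{\smile},1')$ in which $\varphi$ fails and in which all the other axioms of $\mathcal{S}$ are valid.
   Context: All algebras have the form $\mathfrak{A}=(A,+,-,;,{}^{\smile},1')$, where $A$ is a non-empty set, $+$ and $;$ are binary operations on $A$, $-$ and ${}^{\smile}$ are unary operations on $A$, and $1'$ is a distinguished element of $A$. Unary operations bind more tightly than binary ones, and $;$ binds more tightly than $+$. An axiom is valid in $\mathfrak{A}$ if it holds for all elements $r,s,t\in A$; otherwise it fails in $\mathfrak{A}$. The axioms of $\mathcal{S}$ are: (R1) $r+s=s+r$; (R2) $r+(s+t)=(r+s)+t$; (R3) $-(-r+s)+-(-r+-s)=r$; (R4) $r;(s;t)=(r;s);t$; (R5) $r;1'=r$; (R6) $(r^{\smile})^{\smile}=r$; (R8) $(r+s);t=r;t+s;t$; (R8$'$) $r;(s+t)=r;s+r;t$; (R10) $r^{\smile};-(r;s)+-s=-s$, i.e. $\bigl((r^{\smile});(-(r;s))\bigr)+(-s)=-s$. A set of axioms is independent if none of the axioms in it can be derived from the remaining ones; for each axiom this is witnessed by a model in which that axiom fails and all the remaining axioms are valid. -}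

module Defs where

open import Data.Nat.Base using (ℕ)
open import Data.Product.Base using (_×_; Σ-syntax)
open import Level using (0ℓ)
open import Relation.Binary.PropositionalEquality.Core using (_≡_)
open import Relation.Nullary.Negation.Core using (¬_)
open import Relation.Unary using (Pred; _∈_; _∖_; ｛_｝)

-- The operation written ";" on paper is written "⨾", since ";" is reserved.
-- The carrier is non-empty because it contains 1′.

record Algebra : Set₁ where
  infix  9 _˘
  infix  8 -_
  infixl 7 _⨾_
  infixl 6 _+_
  field
    Carrier : Set
    _+_     : Carrier → Carrier → Carrier
    -_      : Carrier → Carrier
    _⨾_     : Carrier → Carrier → Carrier
    _˘      : Carrier → Carrier
    1′      : Carrier

infix  9 _˘
infix  8 -_
infixl 7 _⨾_
infixl 6 _+_

data Term : Set where
  var : ℕ → Term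
  _+_ : Term → Term → Term
  -_  : Term → Term
  _⨾_ : Term → Term → Term
  _˘  : Term → Term
  1′  : Term

infix 5 _≈_

data Equation : Set where
  _≈_ : Term → Term → Equation

module _ (𝔄 : Algebra) where
  private module A = Algebra 𝔄

  ⟦_⟧ : Term → (ℕ → A.Carrier) → A.Carrier
  ⟦ var x ⟧ ρ = ρ x
  ⟦ p + q ⟧ ρ = ⟦ p ⟧ ρ A.+ ⟦ q ⟧ ρ
  ⟦ - p   ⟧ ρ = A.- ⟦ p ⟧ ρ
  ⟦ p ⨾ q ⟧ ρ = ⟦ p ⟧ ρ A.⨾ ⟦ q ⟧ ρ
  ⟦ p ˘   ⟧ ρ = (⟦ p ⟧ ρ) A.˘
  ⟦ 1′    ⟧ ρ = A.1′

infix 3 _⊨_ _⊢_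

_⊨_ : Algebra → Equation → Set
𝔄 ⊨ p ≈ q = ∀ (ρ : ℕ → Algebra.Carrier 𝔄) → ⟦_⟧ 𝔄 p ρ ≡ ⟦_⟧ 𝔄 q ρ

infix 10 _[_]

_[_] : Term → (ℕ → Term) → Term
var x   [ σ ] = σ x
(p + q) [ σ ] = p [ σ ] + q [ σ ]
(- p)   [ σ ] = - p [ σ ]
(p ⨾ q) [ σ ] = p [ σ ] ⨾ q [ σ ]
(p ˘)   [ σ ] = p [ σ ] ˘
1′      [ σ ] = 1′

-- Derivability in Birkhoff's equational logic.

data _⊢_ (Γ : Pred Equation 0ℓ) : Equation → Set where
  axiom  : ∀ {p q} → p ≈ q ∈ Γ → (σ : ℕ → Term) → Γ ⊢ p [ σ ] ≈ q [ σ ]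
  refl   : ∀ {p} → Γ ⊢ p ≈ p
  sym    : ∀ {p q} → Γ ⊢ p ≈ q → Γ ⊢ q ≈ p
  trans  : ∀ {p q u} → Γ ⊢ p ≈ q → Γ ⊢ q ≈ u → Γ ⊢ p ≈ u
  +-cong : ∀ {p p′ q q′} → Γ ⊢ p ≈ p′ → Γ ⊢ q ≈ q′ → Γ ⊢ p + q ≈ p′ + q′
  ⁻-cong : ∀ {p p′} → Γ ⊢ p ≈ p′ → Γ ⊢ - p ≈ - p′
  ⨾-cong : ∀ {p p′ q q′} → Γ ⊢ p ≈ p′ → Γ ⊢ q ≈ q′ → Γ ⊢ p ⨾ q ≈ p′ ⨾ q′
  ˘-cong : ∀ {p p′} → Γ ⊢ p ≈ p′ → Γ ⊢ p ˘ ≈ p′ ˘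

Independent : Pred Equation 0ℓ → Set₁
Independent Γ = ∀ φ → φ ∈ Γ →
    ¬ (Γ ∖ ｛ φ ｝ ⊢ φ)
  × (Σ[ 𝔄 ∈ Algebra ] (¬ (𝔄 ⊨ φ)) × (∀ ψ → ψ ∈ Γ ∖ ｛ φ ｝ → 𝔄 ⊨ ψ))

private
  r s t : Term
  r = var 0
  s = var 1
  t = var 2

data 𝒮 : Pred Equation 0ℓ where
  R1  : 𝒮 (r + s ≈ s + r)
  R2  : 𝒮 (r + (s + t) ≈ (r + s) + t)
  R3  : 𝒮 (- (- r + s) + - (- r + - s) ≈ r)
  R4  : 𝒮 (r ⨾ (s ⨾ t) ≈ (r ⨾ s) ⨾ t)
  R5  : 𝒮 (r ⨾ 1′ ≈ r)
  R6  : 𝒮 ((r ˘) ˘ ≈ r)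
  R8  : 𝒮 ((r + s) ⨾ t ≈ r ⨾ t + s ⨾ t)
  R8′ : 𝒮 (r ⨾ (s + t) ≈ r ⨾ s + r ⨾ t)
  R10 : 𝒮 (r ˘ ⨾ - (r ⨾ s) + - s ≈ - s)

{-# OPTIONS --safe #-}

-- Each axiom is refuted in a finite algebra, all other axioms being verified by
-- exhausting the carrier.  Apart from the countermodels for (R1) and (R2) these are
-- powerset algebras.  The hard case is (R8): if every r ⊆ X is assigned a relation
-- on X whose image of a base point is r, and these relations form a monoid closed
-- under converse, then letting r ⨾ s be the image of s under the relation of r
-- yields every axiom except (R8), which fails unless the relations are closed under
-- union.  On X = ℤ/3 the relations ∅, the rotations, the complements of the
-- reflections, and X × X form such a monoid.
module Submission where

open import Defs

open import Data.Bool.Base using (Bool; true; false; if_then_else_; _∧_; _∨_; _xor_)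
import Data.Bool.Properties as Bool
open import Data.Fin.Base using (Fin)
open import Data.Fin.Patterns
import Data.Fin.Properties as Fin
open import Data.Fin.Subset using (Subset; ∁; _∪_; _∩_; ⊤; ⊥; ⁅_⁆)
open import Data.Fin.Subset.Properties using (anySubset?)
open import Data.Nat.Base using (ℕ)
open import Data.Product.Base using (∃; _×_; _,_; proj₁; -,_)
open import Data.Vec.Base using ([]; _∷_; zipWith)
import Data.Vec.Properties as Vec
open import Function.Base using (_∘_; const; id)
open import Level using (0ℓ)
open import Relation.Binary.Definitions using (DecidableEquality)
open import Relation.Binary.PropositionalEquality as ≡ using (_≡_; _≢_; cong; cong₂)
open import Relation.Nullary.Decidable
  using (Dec; map′; ¬?; _×-dec_; _→-dec_; decidable-stable; from-yes)
open import Relation.Nullary.Negation.Core using (¬_)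
open import Relation.Unary using (Pred; Decidable; _∈_; _∖_; ｛_｝)

module _ (𝔄 : Algebra) where
  private module A = Algebra 𝔄

  ⟦[]⟧ : ∀ p σ ρ → ⟦_⟧ 𝔄 (p [ σ ]) ρ ≡ ⟦_⟧ 𝔄 p (λ x → ⟦_⟧ 𝔄 (σ x) ρ)
  ⟦[]⟧ (var x) σ ρ = ≡.refl
  ⟦[]⟧ (p + q) σ ρ = cong₂ A._+_ (⟦[]⟧ p σ ρ) (⟦[]⟧ q σ ρ)
  ⟦[]⟧ (- p)   σ ρ = cong A.-_ (⟦[]⟧ p σ ρ)
  ⟦[]⟧ (p ⨾ q) σ ρ = cong₂ A._⨾_ (⟦[]⟧ p σ ρ) (⟦[]⟧ q σ ρ)
  ⟦[]⟧ (p ˘)   σ ρ = cong A._˘ (⟦[]⟧ p σ ρ)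
  ⟦[]⟧ 1′      σ ρ = ≡.refl

  soundness : ∀ {Γ φ} → Γ ⊢ φ → (∀ ψ → ψ ∈ Γ → 𝔄 ⊨ ψ) → 𝔄 ⊨ φ
  soundness (axiom {p} {q} p≈q∈Γ σ) ⊨Γ ρ =
    ≡.trans (⟦[]⟧ p σ ρ) (≡.trans (⊨Γ (p ≈ q) p≈q∈Γ _) (≡.sym (⟦[]⟧ q σ ρ)))
  soundness refl         ⊨Γ ρ = ≡.refl
  soundness (sym d)      ⊨Γ ρ = ≡.sym (soundness d ⊨Γ ρ)
  soundness (trans d e)  ⊨Γ ρ = ≡.trans (soundness d ⊨Γ ρ) (soundness e ⊨Γ ρ)
  soundness (+-cong d e) ⊨Γ ρ = cong₂ A._+_ (soundness d ⊨Γ ρ) (soundness e ⊨Γ ρ)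
  soundness (⁻-cong d)   ⊨Γ ρ = cong A.-_ (soundness d ⊨Γ ρ)
  soundness (⨾-cong d e) ⊨Γ ρ = cong₂ A._⨾_ (soundness d ⊨Γ ρ) (soundness e ⊨Γ ρ)
  soundness (˘-cong d)   ⊨Γ ρ = cong A._˘ (soundness d ⊨Γ ρ)

-- Indexing by `Fin 9` turns "all other axioms hold" into a finite check for `Fin.all?`.
axioms : Fin 9 → ∃ 𝒮
axioms 0F = -, R1
axioms 1F = -, R2
axioms 2F = -, R3
axioms 3F = -, R4
axioms 4F = -, R5
axioms 5F = -, R6
axioms 6F = -, R8
axioms 7F = -, R8′
axioms 8F = -, R10

equation : Fin 9 → Equation
equation = proj₁ ∘ axioms

position : ∀ {φ} → φ ∈ 𝒮 → ∃ λ i → equation i ≡ φ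
position R1  = 0F , ≡.refl
position R2  = 1F , ≡.refl
position R3  = 2F , ≡.refl
position R4  = 3F , ≡.refl
position R5  = 4F , ≡.refl
position R6  = 5F , ≡.refl
position R8  = 6F , ≡.refl
position R8′ = 7F , ≡.refl
position R10 = 8F , ≡.refl

env : {A : Set} → A → A → A → ℕ → A
env a b c 0 = a
env a b c 1 = b
env a b c _ = c

infix 3 _⊨₃_

-- Validity under three-variable assignments, which is decidable in a finite algebra.
_⊨₃_ : Algebra → Equation → Set
𝔄 ⊨₃ p ≈ q = ∀ a b c → ⟦_⟧ 𝔄 p (env a b c) ≡ ⟦_⟧ 𝔄 q (env a b c)

⊨⇒⊨₃ : ∀ 𝔄 φ → 𝔄 ⊨ φ → 𝔄 ⊨₃ φ
⊨⇒⊨₃ 𝔄 (p ≈ q) h a b c = h (env a b c)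

-- The axioms mention only variables 0, 1, 2. Splitting on `i` makes the equation concrete, so that
-- `ρ` and its restriction evaluate alike definitionally.
⊨₃⇒⊨ : ∀ 𝔄 i → 𝔄 ⊨₃ equation i → 𝔄 ⊨ equation i
⊨₃⇒⊨ 𝔄 0F h ρ = h (ρ 0) (ρ 1) (ρ 2)
⊨₃⇒⊨ 𝔄 1F h ρ = h (ρ 0) (ρ 1) (ρ 2)
⊨₃⇒⊨ 𝔄 2F h ρ = h (ρ 0) (ρ 1) (ρ 2)
⊨₃⇒⊨ 𝔄 3F h ρ = h (ρ 0) (ρ 1) (ρ 2)
⊨₃⇒⊨ 𝔄 4F h ρ = h (ρ 0) (ρ 1) (ρ 2)
⊨₃⇒⊨ 𝔄 5F h ρ = h (ρ 0) (ρ 1) (ρ 2)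
⊨₃⇒⊨ 𝔄 6F h ρ = h (ρ 0) (ρ 1) (ρ 2)
⊨₃⇒⊨ 𝔄 7F h ρ = h (ρ 0) (ρ 1) (ρ 2)
⊨₃⇒⊨ 𝔄 8F h ρ = h (ρ 0) (ρ 1) (ρ 2)

Separates : Algebra → Fin 9 → Set
Separates 𝔄 i = ¬ (𝔄 ⊨₃ equation i) × (∀ j → j ≢ i → 𝔄 ⊨₃ equation j)

Exhaustible : Set → Set₁
Exhaustible A = ∀ {P : Pred A 0ℓ} → Decidable P → Dec (∀ x → P x)

module _ (𝔄 : Algebra) (all? : Exhaustible (Algebra.Carrier 𝔄))
         (_≟_ : DecidableEquality (Algebra.Carrier 𝔄)) where

  ⊨₃? : Decidable (𝔄 ⊨₃_)
  ⊨₃? (p ≈ q) = all? λ a → all? λ b → all? λ c →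
    ⟦_⟧ 𝔄 p (env a b c) ≟ ⟦_⟧ 𝔄 q (env a b c)

  separates? : Decidable (Separates 𝔄)
  separates? i = ¬? (⊨₃? (equation i)) ×-dec
    Fin.all? λ j → ¬? (j Fin.≟ i) →-dec ⊨₃? (equation j)

allSubset? : ∀ {n} → Exhaustible (Subset n)
allSubset? P? = map′
  -- The search is for a counterexample; decidability of `P` removes the double negation.
  (λ ∄¬P x → decidable-stable (P? x) λ ¬Px → ∄¬P (x , ¬Px))
  (λ ∀P (x , ¬Px) → ¬Px (∀P x))
  (¬? (anySubset? (¬? ∘ P?)))

_≟ˢ_ : ∀ {n} → DecidableEquality (Subset n)
_≟ˢ_ = Vec.≡-dec Bool._≟_

powerset : ∀ {n} → (Subset n → Subset n → Subset n) → (Subset n → Subset n) → Subset n → Algebra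
powerset {n} _∙_ _⁻¹ ε = record
  { Carrier = Subset n
  ; _+_     = _∪_
  ; -_      = ∁
  ; _⨾_     = _∙_
  ; _˘      = _⁻¹
  ; 1′      = ε
  }

-- With r + s = r, equation (R10) says r ˘ ⨾ (r ⨾ s) = s, which holds in a group.
𝔄₁ : Algebra
𝔄₁ = record
  { Carrier = Subset 1
  ; _+_     = λ r s → r
  ; -_      = id
  ; _⨾_     = zipWith _xor_
  ; _˘      = id
  ; 1′      = ⊥
  }

pattern 𝟘 = 0F
pattern ⊕ = 1F
pattern ⊖ = 2F

-- The signs 0, ⊕, ⊖ with the usual product, where ⊕ + ⊖ = 0.
𝔄₂ : Algebra
𝔄₂ = record
  { Carrier = Fin 3
  ; _+_     = plus
  ; -_      = neg
  ; _⨾_     = times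
  ; _˘      = id
  ; 1′      = ⊕
  }
  where
  neg : Fin 3 → Fin 3
  neg 𝟘 = 𝟘
  neg ⊕ = ⊖
  neg ⊖ = ⊕

  plus : Fin 3 → Fin 3 → Fin 3
  plus 𝟘 s = s
  plus r 𝟘 = r
  plus ⊕ ⊕ = ⊕
  plus ⊖ ⊖ = ⊖
  plus ⊕ ⊖ = 𝟘
  plus ⊖ ⊕ = 𝟘

  times : Fin 3 → Fin 3 → Fin 3
  times 𝟘 s = 𝟘
  times ⊕ s = s
  times ⊖ s = neg s

-- With complement constantly `⊤`, both sides of (R10) are `⊤`, and (R3) fails at `⊥`.
𝔄₃ : Algebra
𝔄₃ = record (powerset {1} _∩_ id ⊤) { -_ = const ⊤ }

-- The atoms a, b multiply by a ⨾ a = a, a ⨾ b = ∅, b ⨾ a = b, b ⨾ b = a,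
-- so (b ⨾ b) ⨾ b = ∅ while b ⨾ (b ⨾ b) = b.
𝔄₄ : Algebra
𝔄₄ = powerset {2} _∙_ id ⁅ 0F ⁆
  where
  _∙_ : Subset 2 → Subset 2 → Subset 2
  (a₁ ∷ b₁ ∷ []) ∙ (a₂ ∷ b₂ ∷ []) = (a₁ ∧ a₂ ∨ b₁ ∧ b₂) ∷ (b₁ ∧ a₂) ∷ []

𝔄₅ : Algebra
𝔄₅ = powerset {1} (λ r s → ⊥) id ⊤

𝔄₆ : Algebra
𝔄₆ = powerset {1} _∩_ (const ⊥) ⊤

-- An element r stands for the relation on ℤ/3 sending x to r + x if r has at most
-- one point, and to r − x otherwise.
𝔄₈ : Algebra
𝔄₈ = powerset {3} compose converse ⁅ 0F ⁆
  where
  several : Subset 3 → Bool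
  several (a ∷ b ∷ c ∷ []) = a ∧ b ∨ b ∧ c ∨ c ∧ a

  rotate : Subset 3 → Subset 3
  rotate (a ∷ b ∷ c ∷ []) = c ∷ a ∷ b ∷ []

  reflect : Subset 3 → Subset 3
  reflect (a ∷ b ∷ c ∷ []) = a ∷ c ∷ b ∷ []

  row : Subset 3 → Fin 3 → Subset 3
  row r 0F = r
  -- `rotate` adds 1 in ℤ/3, so applying it twice subtracts 1.
  row r 1F = if several r then rotate (rotate r) else rotate r
  row r 2F = if several r then rotate r else rotate (rotate r)

  compose : Subset 3 → Subset 3 → Subset 3
  compose r (x ∷ y ∷ z ∷ []) =
    (if x then row r 0F else ⊥) ∪ (if y then row r 1F else ⊥) ∪ (if z then row r 2F else ⊥)

  converse : Subset 3 → Subset 3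
  -- y ∈ r - x is symmetric in x and y, whereas y ∈ r + x means x ∈ -r + y.
  converse r = if several r then r else reflect r

-- (R8′) fails for `s = ⁅ 0F ⁆`, `t = ⁅ 1F ⁆` and non-empty `r`, as `r ⨾ ⊤` is `⊥`. In (R10),
-- `r ˘ ⨾ - (r ⨾ s)` is non-empty only for `r = ⁅ 1F ⁆`, `s = ⁅ 0F ⁆`, where it equals `- s`.
𝔄₈′ : Algebra
𝔄₈′ = powerset {2} (λ { r (true ∷ false ∷ []) → r ; _ _ → ⊥ }) id ⁅ 0F ⁆

𝔄₁₀ : Algebra
𝔄₁₀ = powerset {1} _∪_ id ⊥

countermodel : ∀ i → ∃ λ 𝔄 → Separates 𝔄 i
countermodel 0F = 𝔄₁ , from-yes (separates? 𝔄₁ allSubset? _≟ˢ_ 0F)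
countermodel 1F = 𝔄₂ , from-yes (separates? 𝔄₂ Fin.all? Fin._≟_ 1F)
countermodel 2F = 𝔄₃ , from-yes (separates? 𝔄₃ allSubset? _≟ˢ_ 2F)
countermodel 3F = 𝔄₄ , from-yes (separates? 𝔄₄ allSubset? _≟ˢ_ 3F)
countermodel 4F = 𝔄₅ , from-yes (separates? 𝔄₅ allSubset? _≟ˢ_ 4F)
countermodel 5F = 𝔄₆ , from-yes (separates? 𝔄₆ allSubset? _≟ˢ_ 5F)
countermodel 6F = 𝔄₈ , from-yes (separates? 𝔄₈ allSubset? _≟ˢ_ 6F)
countermodel 7F = 𝔄₈′ , from-yes (separates? 𝔄₈′ allSubset? _≟ˢ_ 7F)
countermodel 8F = 𝔄₁₀ , from-yes (separates? 𝔄₁₀ allSubset? _≟ˢ_ 8F)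

theorem5 : Independent 𝒮
theorem5 φ φ∈𝒮 with position φ∈𝒮
... | i , ≡.refl with countermodel i
... | 𝔄 , fails , holds = (λ d → invalid (soundness 𝔄 d others)) , 𝔄 , invalid , others
  where
  invalid : ¬ (𝔄 ⊨ equation i)
  invalid = fails ∘ ⊨⇒⊨₃ 𝔄 (equation i)

  others : ∀ ψ → ψ ∈ 𝒮 ∖ ｛ equation i ｝ → 𝔄 ⊨ ψ
  others ψ (ψ∈𝒮 , φ≢ψ) with position ψ∈𝒮
  ... | j , ≡.refl = ⊨₃⇒⊨ 𝔄 j (holds j λ j≡i → φ≢ψ (cong equation (≡.sym j≡i)))
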